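{- For all positive integers $\rho$ and $v$ (for which $\beta(\rho,v,4)$ is defined), \[ \beta(\rho,v,4) \le \rho\left( (8\rho - 7) + \max\left\{ 12, \left\lfloor \frac{v-4\rho}{3} \right\rfloor \right\} \right). \]
   Context: For integers $v \ge k \ge 2$, a $(v,k)$-packing is a pair $(X,\mathcal{B})$ where $X$ is a set of $v$ points and $\mathcal{B}$ is a set of $k$-subsets of $X$ (blocks) such that every pair of distinct points lies in at most one block. A partial parallel class (PPC) is a set of pairwise disjoint blocks; its size is the number of blocks. A PPC of size $\rho$ is maximum if the packing has no PPC of size $\rho+1$. $\beta(\rho,v,k)$ denotes the maximum number of blocks in a $(v,k)$-packing in which the maximum PPC has size $\rho$. -}

module Defs where

open import Data.Nat using (ℕ; suc; _≤_)
open import Data.Fin using (Fin)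
open import Data.Fin.Subset using (Subset; _∈_; _∩_; Empty; ∣_∣)
open import Data.List using (List; length)
import Data.List.Membership.Propositional as List
open import Data.List.Relation.Binary.Subset.Propositional using (_⊆_)
open import Data.List.Relation.Unary.AllPairs using (AllPairs)
open import Data.List.Relation.Unary.Unique.Propositional using (Unique)
open import Data.Product using (_×_; ∃-syntax)
open import Relation.Binary.PropositionalEquality using (_≡_; _≢_)
open import Relation.Nullary using (¬_)

-- The point set is Fin v.  A finite set of blocks is a duplicate-free list, so
-- its cardinality is the length of the list.
record Packing (v k : ℕ) : Set where
  field
    2≤k        : 2 ≤ k
    k≤v        : k ≤ v
    blocks     : List (Subset v)
    unique     : Unique blocks
    block-size : ∀ {B} → B List.∈ blocks → ∣ B ∣ ≡ k
    pair-once  : ∀ {x y : Fin v} → x ≢ y →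
                 ∀ {B C} → B List.∈ blocks → C List.∈ blocks →
                 x ∈ B → y ∈ B → x ∈ C → y ∈ C → B ≡ C

open Packing public

Disjoint : ∀ {v} → Subset v → Subset v → Set
Disjoint B C = Empty (B ∩ C)

record PPC {v k : ℕ} (D : Packing v k) (ρ : ℕ) : Set where
  field
    members  : List (Subset v)
    distinct : Unique members
    size     : length members ≡ ρ
    subset   : members ⊆ blocks D
    disjoint : AllPairs Disjoint members

MaximumPPCSize : ∀ {v k} → Packing v k → ℕ → Set
MaximumPPCSize D ρ = PPC D ρ × ¬ PPC D (suc ρ)

-- β is a partial function, since for some parameters there is no packing whose
-- maximum partial parallel class has size ρ.  It is therefore given by its
-- graph: Isβ ρ v k b says that β(ρ,v,k) is defined and equal to b.
Isβ : (ρ v k b : ℕ) → Set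
Isβ ρ v k b =
  (∃[ D ] MaximumPPCSize {v} {k} D ρ × length (blocks D) ≡ b) ×
  (∀ (D : Packing v k) → MaximumPPCSize D ρ → length (blocks D) ≤ b)

{-# OPTIONS --safe #-}

-- Let Ps be a maximum PPC.  Every block outside Ps meets some member of Ps, by
-- maximality.  A block meeting two members contains one of the 16 point pairs
-- they span, and no two blocks contain the same pair: there are at most
-- 16 · ρ(ρ-1)/2 such blocks.  Every other block outside Ps ("lone") meets ⋃ Ps
-- in a single point.  If lone blocks A and B meet the same P ∈ Ps in different
-- points, they are not disjoint, as otherwise replacing P by A and B would
-- enlarge Ps.  So when some x ∈ P lies on four lone blocks, every lone block
-- meeting P contains x, for it cannot meet four blocks through x in its three
-- points off P; without x these blocks are disjoint triples outside ⋃ Ps.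
-- When there is no such x, at most 4 · 3 lone blocks meet P.
module Submission where

open import Defs
open import Data.Bool.Properties using () renaming (_≟_ to _≟ᵇ_)
open import Data.Fin using (Fin; zero; suc)
open import Data.Fin.Properties using () renaming (_≟_ to _≟ᶠ_)
open import Data.Fin.Subset
  using (Subset; inside; outside; _∈_; _∉_; _∩_; _∪_; _-_; ⋃; ∣_∣; ⁅_⁆; Nonempty)
open import Data.Fin.Subset.Properties
  using (_∈?_; nonempty?; x∈p∩q⁺; x∈p∩q⁻; x∈p∪q⁻; ∉⊥; p─q⊆p; p─⊥≡p;
         x∈p∧x≢y⇒x∈p-y; drop-∷-Empty; ∣p∣≤n)
open import Data.List using (List; []; _∷_; [_]; _++_; length; map; filter)
open import Data.List.Properties using (length-++; length-map)
import Data.List.Membership.Propositional as List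
open import Data.List.Membership.Propositional using (find; lose)
open import Data.List.Membership.Propositional.Properties
  using (∈-map⁺; ∈-map⁻; ∈-++⁺ˡ; ∈-++⁺ʳ; ∈-++⁻; ∈-filter⁺; ∈-filter⁻; ∈-∃++)
import Data.List.Membership.DecPropositional as DecMembership
open import Data.List.Relation.Binary.Permutation.Propositional
  using (_↭_; ↭-sym; ↭⇒↭ₛ)
open import Data.List.Relation.Binary.Permutation.Propositional.Properties
  using (shift; ↭-length; ∈-resp-↭)
import Data.List.Relation.Binary.Permutation.Setoid.Properties as Permutationₛ
open import Data.List.Relation.Binary.Subset.Propositional using (_⊆_)
open import Data.List.Relation.Unary.All as All using (All; []; _∷_)
open import Data.List.Relation.Unary.AllPairs as AllPairs using (AllPairs; []; _∷_)
import Data.List.Relation.Unary.All.Properties as All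
open import Data.List.Relation.Unary.Any as Any using (Any; here; there; any?)
open import Data.List.Relation.Unary.Unique.Propositional using (Unique)
import Data.List.Relation.Unary.Unique.Propositional.Properties as Unique
open import Data.Nat
  using (ℕ; zero; suc; _+_; _*_; _∸_; _⊔_; _≤_; z≤n; s≤s; s≤s⁻¹; _≤?_)
open import Data.Nat.DivMod using (_/_; /-monoˡ-≤; m*n/n≡m)
open import Data.Nat.Properties
open import Data.Nat.Tactic.RingSolver using (solve-∀)
open import Data.Product using (_×_; _,_; proj₁; proj₂)
open import Data.Sum using (_⊎_; inj₁; inj₂)
open import Data.Vec using ([]; _∷_; here; there)
open import Data.Vec.Properties using (≡-dec)
open import Function using (_∘_)
open import Relation.Binary.Definitions using (DecidableEquality)
open import Relation.Binary.PropositionalEquality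
  using (_≡_; _≢_; refl; sym; trans; cong; cong₂; subst; resp₂; setoid; module ≡-Reasoning)
open import Relation.Nullary using (¬_; Dec; yes; no; contradiction; ¬?; _×-dec_)
open import Relation.Nullary.Decidable using (decidable-stable)
open import Relation.Unary using (Decidable)

private
  variable
    A I : Set
    n : ℕ

-- Counting in lists

length-filter-¬? : {P : A → Set} (P? : Decidable P) (xs : List A) →
                   length xs ≡ length (filter P? xs) + length (filter (¬? ∘ P?) xs)
length-filter-¬? P? [] = refl
length-filter-¬? P? (x ∷ xs) with P? x
... | yes _ = cong suc (length-filter-¬? P? xs)
... | no  _ = trans (cong suc (length-filter-¬? P? xs)) (sym (+-suc _ _))

-- The counting principle behind every bound below. `R` is a relation, so an element may belong to
-- several indices; it is counted at the first one, and what remains is covered by the later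
-- indices. A fibre is any duplicate-free list inside `xs` whose entries are related to `i`, so
-- callers never see the filters.
length≤fibres : {R : A → I → Set} (R? : ∀ x i → Dec (R x i)) (c : ℕ)
                (is : List I) {xs : List A} → Unique xs →
                (∀ {x} → x List.∈ xs → Any (R x) is) →
                (∀ {i} → i List.∈ is → ∀ {zs} → Unique zs → zs ⊆ xs →
                  (∀ {z} → z List.∈ zs → R z i) → length zs ≤ c) →
                length xs ≤ length is * c
length≤fibres R? c [] {[]} u cover fibre = z≤n
length≤fibres R? c [] {_ ∷ _} u cover fibre with () ← cover (here refl)
length≤fibres {R = R} R? c (i ∷ is) {xs} u cover fibre = begin
  length xs                            ≡⟨ length-filter-¬? Rᵢ? xs ⟩
  length (filter Rᵢ? xs) + length rest ≤⟨ +-mono-≤ fibreᵢ ih ⟩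
  c + length is * c                    ∎
  where
  open ≤-Reasoning
  Rᵢ? = λ x → R? x i
  rest = filter (¬? ∘ Rᵢ?) xs

  fibreᵢ : length (filter Rᵢ? xs) ≤ c
  fibreᵢ = fibre (here refl) (Unique.filter⁺ Rᵢ? u)
    (proj₁ ∘ ∈-filter⁻ Rᵢ?) (proj₂ ∘ ∈-filter⁻ Rᵢ? {xs = xs})

  rest⊆xs : rest ⊆ xs
  rest⊆xs = proj₁ ∘ ∈-filter⁻ (¬? ∘ Rᵢ?)

  ih : length rest ≤ length is * c
  ih = length≤fibres R? c is (Unique.filter⁺ (¬? ∘ Rᵢ?) u)
    (λ x∈ → Any.tail (proj₂ (∈-filter⁻ (¬? ∘ Rᵢ?) {xs = xs} x∈)) (cover (rest⊆xs x∈)))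
    (λ i∈ uz zs⊆ → fibre (there i∈) uz (rest⊆xs ∘ zs⊆))

length≤1 : {xs : List A} → Unique xs →
           (∀ {x y} → x List.∈ xs → y List.∈ xs → x ≡ y) → length xs ≤ 1
length≤1 []              eq = z≤n
length≤1 ([] ∷ _)        eq = s≤s z≤n
length≤1 ((x≢y ∷ _) ∷ _) eq = contradiction (eq (here refl) (there (here refl))) x≢y

length-mono-⊆ : DecidableEquality A → {xs ys : List A} →
                Unique xs → xs ⊆ ys → length xs ≤ length ys
length-mono-⊆ _≟_ {xs} {ys} u xs⊆ys = subst (length xs ≤_) (*-identityʳ _)
  (length≤fibres _≟_ 1 ys u xs⊆ys
    (λ _ uz _ z≡i → length≤1 uz λ x∈ y∈ → trans (z≡i x∈) (sym (z≡i y∈))))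

-- Each pair appears in one order only; this halving turns the 16 of `crossing-bound` into the 8 of
-- the theorem.
unorderedPairs : List A → List (A × A)
unorderedPairs []       = []
unorderedPairs (x ∷ xs) = map (x ,_) xs ++ unorderedPairs xs

-- The binomial coefficient, written without division or truncated subtraction: both orders of each
-- pair together with the diagonal fill the square.
length-unorderedPairs : (xs : List A) →
  length (unorderedPairs xs) * 2 + length xs ≡ length xs * length xs
length-unorderedPairs []       = refl
length-unorderedPairs (x ∷ xs) = begin
  length (map (x ,_) xs ++ ps) * 2 + suc l
    ≡⟨ cong (λ k → k * 2 + suc l) (length-++ (map (x ,_) xs)) ⟩
  (length (map (x ,_) xs) + length ps) * 2 + suc l
    ≡⟨ cong (λ k → (k + length ps) * 2 + suc l) (length-map (x ,_) xs) ⟩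
  (l + length ps) * 2 + suc l
    ≡⟨ regroup l (length ps) ⟩
  (length ps * 2 + l) + suc (2 * l)
    ≡⟨ cong (_+ suc (2 * l)) (length-unorderedPairs xs) ⟩
  l * l + suc (2 * l)
    ≡⟨ square l ⟩
  suc l * suc l ∎
  where
  open ≡-Reasoning
  ps = unorderedPairs xs
  l = length xs
  regroup : ∀ l p → (l + p) * 2 + suc l ≡ (p * 2 + l) + suc (2 * l)
  regroup = solve-∀
  square : ∀ l → l * l + suc (2 * l) ≡ suc l * suc l
  square = solve-∀

∈-unorderedPairs⁺ : {xs : List A} {x y : A} → x List.∈ xs → y List.∈ xs → x ≢ y →
  (x , y) List.∈ unorderedPairs xs ⊎ (y , x) List.∈ unorderedPairs xs
∈-unorderedPairs⁺ (here refl) (here refl) x≢y = contradiction refl x≢y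
∈-unorderedPairs⁺ (here refl) (there y∈)  x≢y = inj₁ (∈-++⁺ˡ (∈-map⁺ _ y∈))
∈-unorderedPairs⁺ (there x∈)  (here refl) x≢y = inj₂ (∈-++⁺ˡ (∈-map⁺ _ x∈))
∈-unorderedPairs⁺ {xs = z ∷ xs} (there x∈) (there y∈) x≢y
  with ∈-unorderedPairs⁺ x∈ y∈ x≢y
... | inj₁ p = inj₁ (∈-++⁺ʳ (map (z ,_) xs) p)
... | inj₂ p = inj₂ (∈-++⁺ʳ (map (z ,_) xs) p)

∈-unorderedPairs⁻ : {xs : List A} {x y : A} → (x , y) List.∈ unorderedPairs xs →
  x List.∈ xs × y List.∈ xs
∈-unorderedPairs⁻ {xs = z ∷ xs} p with ∈-++⁻ (map (z ,_) xs) p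
... | inj₁ q with _ , y∈ , refl ← ∈-map⁻ (z ,_) q = here refl , there y∈
... | inj₂ q with x∈ , y∈ ← ∈-unorderedPairs⁻ {xs = xs} q = there x∈ , there y∈

AllPairs-unorderedPairs : {R : A → A → Set} {xs : List A} → AllPairs R xs →
  ∀ {x y} → (x , y) List.∈ unorderedPairs xs → R x y
AllPairs-unorderedPairs {xs = z ∷ xs} (rs ∷ ap) p with ∈-++⁻ (map (z ,_) xs) p
... | inj₁ q with _ , y∈ , refl ← ∈-map⁻ (z ,_) q = All.lookup rs y∈
... | inj₂ q = AllPairs-unorderedPairs ap q

-- Finite subsets

infix 4 _≟ˢ_
_≟ˢ_ : DecidableEquality (Subset n)
_≟ˢ_ = ≡-dec _≟ᵇ_

elements : Subset n → List (Fin n)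
elements []            = []
elements (inside  ∷ p) = zero ∷ map suc (elements p)
elements (outside ∷ p) = map suc (elements p)

length-elements : (p : Subset n) → length (elements p) ≡ ∣ p ∣
length-elements []            = refl
length-elements (inside  ∷ p) = cong suc (trans (length-map suc (elements p)) (length-elements p))
length-elements (outside ∷ p) = trans (length-map suc (elements p)) (length-elements p)

∈-elements⁺ : {p : Subset n} {x : Fin n} → x ∈ p → x List.∈ elements p
∈-elements⁺ {p = inside  ∷ p} here       = here refl
∈-elements⁺ {p = inside  ∷ p} (there x∈) = there (∈-map⁺ suc (∈-elements⁺ x∈))
∈-elements⁺ {p = outside ∷ p} (there x∈) = ∈-map⁺ suc (∈-elements⁺ x∈)

∈-elements⁻ : {p : Subset n} {x : Fin n} → x List.∈ elements p → x ∈ p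
∈-elements⁻ {p = inside ∷ p} (here refl) = here
∈-elements⁻ {p = inside ∷ p} (there x∈)
  with _ , y∈ , refl ← ∈-map⁻ suc x∈ = there (∈-elements⁻ y∈)
∈-elements⁻ {p = outside ∷ p} x∈
  with _ , y∈ , refl ← ∈-map⁻ suc x∈ = there (∈-elements⁻ y∈)

-- `length≤fibres` with the points of `p` as indices: each block is charged to a point that it
-- shares with `p`.
length≤points : {p : Subset n} {xs : List (Subset n)} (c : ℕ) → Unique xs →
  (∀ {B} → B List.∈ xs → Nonempty (B ∩ p)) →
  (∀ {x} → x ∈ p → ∀ {zs} → Unique zs → zs ⊆ xs →
    (∀ {B} → B List.∈ zs → x ∈ B) → length zs ≤ c) →
  length xs ≤ ∣ p ∣ * c
length≤points {p = p} {xs} c u meets fibre =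
  subst (λ k → length xs ≤ k * c) (length-elements p)
    (length≤fibres (λ B x → x ∈? B) c (elements p) u cover (fibre ∘ ∈-elements⁻))
  where
  cover : ∀ {B} → B List.∈ xs → Any (_∈ B) (elements p)
  cover {B} B∈ with x , x∈B∩p ← meets B∈
                with x∈B , x∈p ← x∈p∩q⁻ B p x∈B∩p =
    lose (∈-elements⁺ x∈p) x∈B

x∈p⇒1+∣p-x∣≡∣p∣ : {p : Subset n} {x : Fin n} → x ∈ p → suc ∣ p - x ∣ ≡ ∣ p ∣
x∈p⇒1+∣p-x∣≡∣p∣ {p = inside  ∷ p} here       = cong (suc ∘ ∣_∣) (p─⊥≡p p)
x∈p⇒1+∣p-x∣≡∣p∣ {p = inside  ∷ p} (there x∈) = cong suc (x∈p⇒1+∣p-x∣≡∣p∣ x∈)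
x∈p⇒1+∣p-x∣≡∣p∣ {p = outside ∷ p} (there x∈) = x∈p⇒1+∣p-x∣≡∣p∣ x∈

x∉p-x : (p : Subset n) (x : Fin n) → x ∉ p - x
x∉p-x (_ ∷ p) (suc x) (there x∈) = x∉p-x p x x∈

∈-⋃⁻ : (Bs : List (Subset n)) {x : Fin n} → x ∈ ⋃ Bs → Any (x ∈_) Bs
∈-⋃⁻ []       x∈ = contradiction x∈ ∉⊥
∈-⋃⁻ (B ∷ Bs) x∈ with x∈p∪q⁻ B (⋃ Bs) x∈
... | inj₁ x∈B = here x∈B
... | inj₂ x∈⋃ = there (∈-⋃⁻ Bs x∈⋃)

Disjoint⁺ : {B C : Subset n} → (∀ {x} → x ∈ B → x ∉ C) → Disjoint B C
Disjoint⁺ {B = B} {C} h (x , x∈) with x∈B , x∈C ← x∈p∩q⁻ B C x∈ = h x∈B x∈C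

Disjoint⁻ : {B C : Subset n} → Disjoint B C → ∀ {x} → x ∈ B → x ∉ C
Disjoint⁻ d x∈B x∈C = d (_ , x∈p∩q⁺ (x∈B , x∈C))

Disjoint-sym : {B C : Subset n} → Disjoint B C → Disjoint C B
Disjoint-sym d = Disjoint⁺ λ x∈C x∈B → Disjoint⁻ d x∈B x∈C

∣p∪q∣-disjoint : {p q : Subset n} → Disjoint p q → ∣ p ∪ q ∣ ≡ ∣ p ∣ + ∣ q ∣
∣p∪q∣-disjoint {p = []}          {[]}          d = refl
∣p∪q∣-disjoint {p = inside  ∷ p} {inside  ∷ q} d = contradiction (zero , here) d
∣p∪q∣-disjoint {p = inside  ∷ p} {outside ∷ q} d = cong suc (∣p∪q∣-disjoint (drop-∷-Empty d))
∣p∪q∣-disjoint {p = outside ∷ p} {inside  ∷ q} d =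
  trans (cong suc (∣p∪q∣-disjoint (drop-∷-Empty d))) (sym (+-suc _ _))
∣p∪q∣-disjoint {p = outside ∷ p} {outside ∷ q} d = ∣p∪q∣-disjoint (drop-∷-Empty d)

∣⋃∣-disjoint : {c : ℕ} {Bs : List (Subset n)} → AllPairs Disjoint Bs →
  (∀ {B} → B List.∈ Bs → ∣ B ∣ ≡ c) → length Bs * c ≤ ∣ ⋃ Bs ∣
∣⋃∣-disjoint [] size = z≤n
∣⋃∣-disjoint {c = c} {B ∷ Bs} (ds ∷ ap) size = begin
  c + length Bs * c  ≤⟨ +-mono-≤ (≤-reflexive (sym (size (here refl))))
                                 (∣⋃∣-disjoint ap (size ∘ there)) ⟩
  ∣ B ∣ + ∣ ⋃ Bs ∣   ≡⟨ sym (∣p∪q∣-disjoint B∥⋃) ⟩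
  ∣ B ∪ ⋃ Bs ∣       ∎
  where
  open ≤-Reasoning
  B∥⋃ : Disjoint B (⋃ Bs)
  B∥⋃ = Disjoint⁺ λ x∈B x∈⋃ → let _ , C∈ , x∈C = find (∈-⋃⁻ Bs x∈⋃) in
    Disjoint⁻ (All.lookup ds C∈) x∈B x∈C

-- Packings with a maximum partial parallel class

∣p∣≡suc⇒Nonempty : {c : ℕ} (p : Subset n) → ∣ p ∣ ≡ suc c → Nonempty p
∣p∣≡suc⇒Nonempty (inside  ∷ p) _  = zero , here
∣p∣≡suc⇒Nonempty (outside ∷ p) eq with x , x∈ ← ∣p∣≡suc⇒Nonempty p eq = suc x , there x∈

-- Distinctness comes for free: a repeated block would be disjoint from itself, hence empty, and
-- `2≤k` excludes empty blocks.
disjointBlocks⇒PPC : ∀ {v k} (D : Packing v k) {Bs : List (Subset v)} →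
  Bs ⊆ blocks D → AllPairs Disjoint Bs → PPC D (length Bs)
disjointBlocks⇒PPC {k = zero} D with () ← 2≤k D
disjointBlocks⇒PPC {k = suc _} D {Bs} Bs⊆ ap = record
  { members = Bs ; distinct = unique-of Bs⊆ ap ; size = refl ; subset = Bs⊆ ; disjoint = ap }
  where
  unique-of : ∀ {Bs} → Bs ⊆ blocks D → AllPairs Disjoint Bs → Unique Bs
  unique-of Bs⊆ []                   = []
  unique-of {B ∷ _} Bs⊆ (ds ∷ ap) = All.map distinct-from-B ds ∷ unique-of (Bs⊆ ∘ there) ap
    where
    distinct-from-B : ∀ {C} → Disjoint B C → B ≢ C
    distinct-from-B d refl
      with x , x∈B ← ∣p∣≡suc⇒Nonempty B (block-size D (Bs⊆ (here refl))) = Disjoint⁻ d x∈B x∈B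

module _ {v : ℕ} (D : Packing v 4) {Ps : List (Subset v)}
         (Ps⊆ : Ps ⊆ blocks D) (Ps-disjoint : AllPairs Disjoint Ps)
         (maximum : ¬ PPC D (suc (length Ps))) where

  -- `P` and `Q` may coincide or differ, so `B` shares at most one point with the union of `Ps`.
  -- That it shares at least one is `block-meets-Ps`.
  Lone : Subset v → Set
  Lone B = ∀ {P Q x y} → P List.∈ Ps → Q List.∈ Ps →
           x ∈ P → x ∈ B → y ∈ Q → y ∈ B → x ≡ y

  Meets : Subset v → Subset v → Set
  Meets B P = Nonempty (B ∩ P)

  MeetsBoth : Subset v → Subset v × Subset v → Set
  MeetsBoth B (P , Q) = Meets B P × Meets B Q

  meetsBoth? : ∀ B PQ → Dec (MeetsBoth B PQ)
  meetsBoth? B (P , Q) = nonempty? (B ∩ P) ×-dec nonempty? (B ∩ Q)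

  Crossing : Subset v → Set
  Crossing B = Any (MeetsBoth B) (unorderedPairs Ps)

  crossing? : Decidable Crossing
  crossing? B = any? (meetsBoth? B) (unorderedPairs Ps)

  _∈Ps? : Decidable (List._∈ Ps)
  B ∈Ps? = DecMembership._∈?_ _≟ˢ_ B Ps

  block-meets-Ps : ∀ {B} → B List.∈ blocks D → Any (Meets B) Ps
  block-meets-Ps {B} B∈ = decidable-stable (any? (λ P → nonempty? (B ∩ P)) Ps) λ none →
    maximum (disjointBlocks⇒PPC D
      (λ { (here refl) → B∈ ; (there C∈) → Ps⊆ C∈ })
      (All.tabulate (λ C∈ meet → none (lose C∈ meet)) ∷ Ps-disjoint))

  -- Two shared points in the same member would make `B` equal to it by `pair-once`; in different
  -- members they would make `B` crossing.
  ¬crossing⇒lone : ∀ {B} → B List.∈ blocks D → ¬ B List.∈ Ps → ¬ Crossing B → Lone B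
  ¬crossing⇒lone {B} B∈ B∉Ps ¬cross {P} {Q} {x} {y} P∈ Q∈ x∈P x∈B y∈Q y∈B
    with P ≟ˢ Q
  ... | yes refl = decidable-stable (x ≟ᶠ y) λ x≢y →
    B∉Ps (subst (List._∈ Ps) (pair-once D x≢y (Ps⊆ P∈) B∈ x∈P y∈Q x∈B y∈B) P∈)
  ... | no P≢Q with ∈-unorderedPairs⁺ P∈ Q∈ P≢Q
  ...   | inj₁ PQ∈ = contradiction
            (lose PQ∈ ((_ , x∈p∩q⁺ (x∈B , x∈P)) , (_ , x∈p∩q⁺ (y∈B , y∈Q)))) ¬cross
  ...   | inj₂ QP∈ = contradiction
            (lose QP∈ ((_ , x∈p∩q⁺ (y∈B , y∈Q)) , (_ , x∈p∩q⁺ (x∈B , x∈P)))) ¬cross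

  -- Counting crossing and lone blocks

  through-two-points : ∀ {x y zs} → x ≢ y → Unique zs → zs ⊆ blocks D →
    (∀ {B} → B List.∈ zs → x ∈ B) → (∀ {B} → B List.∈ zs → y ∈ B) → length zs ≤ 1
  through-two-points x≢y u zs⊆ x∈ y∈ = length≤1 u λ B∈ C∈ →
    pair-once D x≢y (zs⊆ B∈) (zs⊆ C∈) (x∈ B∈) (y∈ B∈) (x∈ C∈) (y∈ C∈)

  -- For each pair of members the blocks are sorted by a point of `P`, then by a point of `Q`: at
  -- most 4 · 4 · 1 of them.
  crossing-bound : ∀ {xs} → Unique xs → xs ⊆ blocks D →
    (∀ {B} → B List.∈ xs → Crossing B) → length xs ≤ length (unorderedPairs Ps) * 16
  crossing-bound {xs} u xs⊆ cross =
    length≤fibres meetsBoth? 16 (unorderedPairs Ps) u cross meetingBoth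
    where
    meetingBoth : ∀ {PQ} → PQ List.∈ unorderedPairs Ps → ∀ {zs} → Unique zs → zs ⊆ xs →
      (∀ {B} → B List.∈ zs → MeetsBoth B PQ) → length zs ≤ 16
    meetingBoth {P , Q} PQ∈ {zs} uz zs⊆ both with P∈ , Q∈ ← ∈-unorderedPairs⁻ {xs = Ps} PQ∈ =
      subst (λ k → length zs ≤ k * 4) (block-size D (Ps⊆ P∈))
        (length≤points 4 uz (proj₁ ∘ both) λ x∈P {ws} uw ws⊆ x∈ →
          subst (λ k → length ws ≤ k * 1) (block-size D (Ps⊆ Q∈))
            (length≤points 1 uw (proj₂ ∘ both ∘ ws⊆) λ y∈Q ut ts⊆ y∈ →
              through-two-points
                -- The two points differ because `P` and `Q` are disjoint.
                (λ { refl → Disjoint⁻ (AllPairs-unorderedPairs Ps-disjoint PQ∈) x∈P y∈Q })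
                ut (xs⊆ ∘ zs⊆ ∘ ws⊆ ∘ ts⊆) (x∈ ∘ ts⊆) y∈))

  lone-exchange : ∀ {P A B x y} → P List.∈ Ps → A List.∈ blocks D → B List.∈ blocks D →
    Lone A → Lone B → x ∈ P → x ∈ A → y ∈ P → y ∈ B → Meets A B
  lone-exchange {P} {A} {B} P∈ A∈ B∈ loneA loneB x∈P x∈A y∈P y∈B
    with as , bs , refl ← ∈-∃++ P∈ =
    decidable-stable (nonempty? (A ∩ B)) λ A∥B → maximum
      (subst (PPC D) (cong suc (sym (↭-length Ps↭)))
        (disjointBlocks⇒PPC D
          (λ { (here refl) → A∈ ; (there (here refl)) → B∈ ; (there (there C∈)) → Ps⊆ (Qs⊆ C∈) })
          ((A∥B ∷ off-Qs loneA x∈P x∈A) ∷ off-Qs loneB y∈P y∈B ∷ AllPairs.tail PQs-disjoint)))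
    where
    Qs = as ++ bs

    -- With `P` moved to the front, its disjointness from the other members is the head of
    -- `PQs-disjoint`. Disjointness is symmetric, so it survives the permutation.
    Ps↭ : as ++ [ P ] ++ bs ↭ P ∷ Qs
    Ps↭ = shift P as bs

    Qs⊆ : Qs ⊆ as ++ [ P ] ++ bs
    Qs⊆ = ∈-resp-↭ (↭-sym Ps↭) ∘ there

    PQs-disjoint : AllPairs Disjoint (P ∷ Qs)
    PQs-disjoint = Permutationₛ.AllPairs-resp-↭ (setoid _) Disjoint-sym (resp₂ _)
      (↭⇒↭ₛ Ps↭) Ps-disjoint

    off-Qs : ∀ {C z} → Lone C → z ∈ P → z ∈ C → All (Disjoint C) Qs
    -- A point of `C` in another member `Q` would equal `z` by loneness, but `z` lies in `P`, which
    -- is disjoint from `Q`.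
    off-Qs loneC z∈P z∈C = All.tabulate λ {Q} Q∈ → Disjoint⁺ λ u∈C u∈Q →
      Disjoint⁻ (All.lookup (AllPairs.head PQs-disjoint) Q∈) z∈P
        (subst (_∈ Q) (sym (loneC P∈ (Qs⊆ Q∈) z∈P z∈C u∈Q u∈C)) u∈Q)

  -- A count of points: the triples left after deleting `x` and the members of `Ps` are all pairwise
  -- disjoint, so 3 points per block of `zs` and 4 per member fit into `v`.
  lone-star-bound : ∀ {x zs P} → P List.∈ Ps → x ∈ P → Unique zs → zs ⊆ blocks D →
    (∀ {B} → B List.∈ zs → Lone B) → (∀ {B} → B List.∈ zs → x ∈ B) →
    length zs ≤ (v ∸ 4 * length Ps) / 3
  lone-star-bound {x} {zs} P∈ x∈P u zs⊆ lone x∈ = begin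
    length zs                     ≡⟨ sym (m*n/n≡m (length zs) 3) ⟩
    length zs * 3 / 3             ≤⟨ /-monoˡ-≤ 3 (m+n≤o⇒m≤o∸n (length zs * 3) total) ⟩
    (v ∸ 4 * length Ps) / 3       ∎
    where
    open ≤-Reasoning
    triples = map (_- x) zs

    triple-size : ∀ {T} → T List.∈ triples → ∣ T ∣ ≡ 3
    triple-size T∈ with B , B∈ , refl ← ∈-map⁻ (_- x) T∈ =
      suc-injective (trans (x∈p⇒1+∣p-x∣≡∣p∣ (x∈ B∈)) (block-size D (zs⊆ B∈)))

    -x-disjoint : ∀ {B C} → B List.∈ blocks D → C List.∈ blocks D → x ∈ B → x ∈ C →
      B ≢ C → Disjoint (B - x) (C - x)
    -- A common point of the two triples would be a second point, besides `x`, shared by `B` and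
    -- `C`.
    -x-disjoint {B} {C} B∈ C∈ x∈B x∈C B≢C = Disjoint⁺ λ y∈B-x y∈C-x →
      B≢C (pair-once D (λ { refl → x∉p-x B x y∈B-x }) B∈ C∈
        x∈B (p─q⊆p B ⁅ x ⁆ y∈B-x) x∈C (p─q⊆p C ⁅ x ⁆ y∈C-x))

    triples-disjoint : ∀ {ws} → Unique ws → ws ⊆ zs → AllPairs Disjoint (map (_- x) ws)
    triples-disjoint []        ws⊆ = []
    triples-disjoint (B≢ ∷ uw) ws⊆ = All.map⁺ (All.tabulate λ C∈ →
        let B∈zs = ws⊆ (here refl) ; C∈zs = ws⊆ (there C∈) in
        -x-disjoint (zs⊆ B∈zs) (zs⊆ C∈zs) (x∈ B∈zs) (x∈ C∈zs) (All.lookup B≢ C∈))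
      ∷ triples-disjoint uw (ws⊆ ∘ there)

    triples-off-Ps : Disjoint (⋃ triples) (⋃ Ps)
    triples-off-Ps = Disjoint⁺ off
      where
      off : ∀ {y} → y ∈ ⋃ triples → y ∉ ⋃ Ps
      off y∈T y∈Ps
        with T , T∈ , y∈B-x ← find (∈-⋃⁻ triples y∈T)
           | Q , Q∈ , y∈Q ← find (∈-⋃⁻ Ps y∈Ps)
        with B , B∈ , refl ← ∈-map⁻ (_- x) T∈
        -- Loneness forces the point `y` of `B` in `Q` to be `x`, which was deleted.
        with refl ← lone B∈ P∈ Q∈ x∈P (x∈ B∈) y∈Q (p─q⊆p B ⁅ x ⁆ y∈B-x) = x∉p-x B x y∈B-x

    total : length zs * 3 + 4 * length Ps ≤ v
    total = begin
      length zs * 3 + 4 * length Ps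
        ≡⟨ cong₂ _+_ (cong (_* 3) (sym (length-map (_- x) zs))) (*-comm 4 (length Ps)) ⟩
      length triples * 3 + length Ps * 4
        ≤⟨ +-mono-≤ (∣⋃∣-disjoint (triples-disjoint u (λ z → z)) triple-size)
                    (∣⋃∣-disjoint Ps-disjoint (block-size D ∘ Ps⊆)) ⟩
      ∣ ⋃ triples ∣ + ∣ ⋃ Ps ∣  ≡⟨ sym (∣p∪q∣-disjoint triples-off-Ps) ⟩
      ∣ ⋃ triples ∪ ⋃ Ps ∣      ≤⟨ ∣p∣≤n (⋃ triples ∪ ⋃ Ps) ⟩
      v                         ∎

  -- The two cases give the two arguments of the maximum: 4 points of `P` with at most 3 blocks
  -- each, or a single star through a heavy point. The threshold 4 is one more than the number of
  -- points of a block off `P`.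
  lone-meeting-bound : ∀ {P zs} → P List.∈ Ps → Unique zs → zs ⊆ blocks D →
    (∀ {B} → B List.∈ zs → Lone B) → (∀ {B} → B List.∈ zs → Meets B P) →
    length zs ≤ 12 ⊔ (v ∸ 4 * length Ps) / 3
  lone-meeting-bound {P} {zs} P∈ u zs⊆ lone meets
    with any? (λ x → 4 ≤? length (filter (x ∈?_) zs)) (elements P)
  ... | no ¬heavy = m≤n⇒m≤n⊔o ((v ∸ 4 * length Ps) / 3)
      (subst (λ k → length zs ≤ k * 3) (block-size D (Ps⊆ P∈))
        (length≤points 3 u meets λ {x} x∈P uw ws⊆ x∈ → s≤s⁻¹ (≰⇒> λ 4≤ → ¬heavy
          (lose (∈-elements⁺ x∈P) (≤-trans 4≤ (length-mono-⊆ _≟ˢ_ uw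
            λ B∈ → ∈-filter⁺ (x ∈?_) (ws⊆ B∈) (x∈ B∈)))))))
  ... | yes heavy with x , x∈elements , 4≤ ← find heavy =
        m≤n⇒m≤o⊔n 12 (lone-star-bound P∈ x∈P u zs⊆ lone through-x)
    where
    x∈P = ∈-elements⁻ x∈elements
    star = filter (x ∈?_) zs

    star⊆ : star ⊆ zs
    star⊆ = proj₁ ∘ ∈-filter⁻ (x ∈?_)

    x∈star : ∀ {A} → A List.∈ star → x ∈ A
    x∈star = proj₂ ∘ ∈-filter⁻ (x ∈?_) {xs = zs}

    through-x : ∀ {B} → B List.∈ zs → x ∈ B
    -- If `B` missed `x`, it would meet `P` in some `y`, and by `lone-exchange` every block of
    -- `star` would meet `B`. That leaves room for three blocks in `star`, against `4≤`.
    through-x {B} B∈ = decidable-stable (x ∈? B) λ x∉B →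
      let y , y∈B∩P = meets B∈
          y∈B , y∈P = x∈p∩q⁻ B P y∈B∩P
      in <⇒≱ 4≤ (star≤3 x∉B y∈B y∈P)
      where
      star≤3 : ∀ {y} → x ∉ B → y ∈ B → y ∈ P → length star ≤ 3
      star≤3 {y} x∉B y∈B y∈P = subst (λ k → length star ≤ k * 1)
        (suc-injective (trans (x∈p⇒1+∣p-x∣≡∣p∣ y∈B) (block-size D (zs⊆ B∈))))
        (length≤points 1 (Unique.filter⁺ (x ∈?_) u) meets-B-y λ {w} w∈ uw ws⊆ w∈ws →
          through-two-points (λ { refl → x∉B (p─q⊆p B ⁅ y ⁆ w∈) })
            uw (zs⊆ ∘ star⊆ ∘ ws⊆) (x∈star ∘ ws⊆) w∈ws)
        where
        meets-B-y : ∀ {A} → A List.∈ star → Meets A (B - y)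
        meets-B-y {A} A∈
          with w , w∈A∩B ← lone-exchange P∈ (zs⊆ (star⊆ A∈)) (zs⊆ B∈)
                             (lone (star⊆ A∈)) (lone B∈) x∈P (x∈star A∈) y∈P y∈B
          with w∈A , w∈B ← x∈p∩q⁻ A B w∈A∩B =
          -- If `w` were `y`, then `A` would meet `P` in both `x` and `y`; loneness of `A` gives
          -- equality, putting `x` in `B`.
          w , x∈p∩q⁺ (w∈A , x∈p∧x≢y⇒x∈p-y w∈B λ { refl →
            x∉B (subst (_∈ B) (sym (lone (star⊆ A∈) P∈ P∈ x∈P (x∈star A∈) y∈P w∈A)) y∈B) })

  -- Adding up the bounds

  lone-bound : ∀ {xs} → Unique xs → xs ⊆ blocks D → (∀ {B} → B List.∈ xs → Lone B) →
    length xs ≤ length Ps * (12 ⊔ (v ∸ 4 * length Ps) / 3)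
  lone-bound u xs⊆ lone =
    length≤fibres (λ B P → nonempty? (B ∩ P)) _ Ps u (block-meets-Ps ∘ xs⊆)
      (λ P∈ uz zs⊆ → lone-meeting-bound P∈ uz (xs⊆ ∘ zs⊆) (lone ∘ zs⊆))

  blocks-bound : length (blocks D) ≤
    length Ps + (length (unorderedPairs Ps) * 16 +
                 length Ps * (12 ⊔ (v ∸ 4 * length Ps) / 3))
  blocks-bound = begin
    length (blocks D)
      ≡⟨ length-filter-¬? _∈Ps? (blocks D) ⟩
    length (filter _∈Ps? (blocks D)) + length others
      ≡⟨ cong (length (filter _∈Ps? (blocks D)) +_) (length-filter-¬? crossing? others) ⟩
    length (filter _∈Ps? (blocks D)) + (length crossings + length lones)
      ≤⟨ +-mono-≤ (length-mono-⊆ _≟ˢ_ (Unique.filter⁺ _∈Ps? (unique D))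
                    (proj₂ ∘ ∈-filter⁻ _∈Ps? {xs = blocks D}))
          (+-mono-≤
            (crossing-bound (Unique.filter⁺ crossing? others-unique)
              (proj₁ ∘ others⁻ ∘ proj₁ ∘ ∈-filter⁻ crossing?)
              (proj₂ ∘ ∈-filter⁻ crossing? {xs = others}))
            (lone-bound (Unique.filter⁺ (¬? ∘ crossing?) others-unique)
              (proj₁ ∘ others⁻ ∘ proj₁ ∘ ∈-filter⁻ (¬? ∘ crossing?))
              lones-lone)) ⟩
    _ ∎
    where
    open ≤-Reasoning
    -- Members of `Ps` are set aside first: `¬crossing⇒lone` applies only to blocks outside `Ps`.
    others = filter (¬? ∘ _∈Ps?) (blocks D)
    crossings = filter crossing? others
    lones = filter (¬? ∘ crossing?) others

    others-unique : Unique others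
    others-unique = Unique.filter⁺ (¬? ∘ _∈Ps?) (unique D)

    others⁻ : ∀ {B} → B List.∈ others → B List.∈ blocks D × ¬ B List.∈ Ps
    others⁻ = ∈-filter⁻ (¬? ∘ _∈Ps?)

    lones-lone : ∀ {B} → B List.∈ lones → Lone B
    lones-lone B∈ with B∈others , ¬cross ← ∈-filter⁻ (¬? ∘ crossing?) {xs = others} B∈
                  with B∈blocks , B∉Ps ← others⁻ B∈others =
      ¬crossing⇒lone B∈blocks B∉Ps ¬cross

-- The hypothesis says that `p` is ρ(ρ-1)/2, so 16p = 8ρ(ρ-1), and adding the ρ members gives
-- ρ(8ρ-7).
regroup-bound : ∀ {ρ} p m → 1 ≤ ρ → p * 2 + ρ ≡ ρ * ρ →
  ρ + (p * 16 + ρ * m) ≡ ρ * ((8 * ρ ∸ 7) + m)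
regroup-bound {suc r} p m _ eq = begin
  suc r + (p * 16 + suc r * m)           ≡⟨ cong (λ k → suc r + (k + suc r * m)) (sym (*-assoc p 2 8)) ⟩
  suc r + (p * 2 * 8 + suc r * m)        ≡⟨ cong (λ k → suc r + (k * 8 + suc r * m)) p*2≡ ⟩
  suc r + (suc r * r * 8 + suc r * m)    ≡⟨ factor r m ⟩
  -- As 8(r+1) = 8 + 8r, subtracting 7 leaves exactly 1 + 8r; no truncation occurs.
  suc r * (suc (8 * r) + m)              ≡⟨ cong (λ k → suc r * (k ∸ 7 + m)) (sym (*-suc 8 r)) ⟩
  suc r * ((8 * suc r ∸ 7) + m)          ∎
  where
  open ≡-Reasoning
  p*2≡ : p * 2 ≡ suc r * r
  p*2≡ = +-cancelʳ-≡ (suc r) (p * 2) (suc r * r)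
    (trans eq (trans (*-suc (suc r) r) (+-comm (suc r) (suc r * r))))
  factor : ∀ r m → suc r + (suc r * r * 8 + suc r * m) ≡ suc r * (suc (8 * r) + m)
  factor = solve-∀

theorem3p2 : ∀ (ρ v b : ℕ) → 1 ≤ ρ → 1 ≤ v → Isβ ρ v 4 b →
    b ≤ ρ * ((8 * ρ ∸ 7) + (12 ⊔ ((v ∸ 4 * ρ) / 3)))
-- `Isβ` supplies a packing `D` with exactly `b` blocks, so bounding the blocks of `D` suffices.
theorem3p2 ρ v b 1≤ρ _ ((D , (ppc , maximum) , refl) , _) with ppc
... | record { members = Ps ; size = refl ; subset = Ps⊆ ; disjoint = Ps-disjoint } =
  subst (b ≤_) (regroup-bound (length (unorderedPairs Ps)) (12 ⊔ (v ∸ 4 * ρ) / 3) 1≤ρ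
                  (length-unorderedPairs Ps))
    (blocks-bound D Ps⊆ Ps-disjoint maximum)
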